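{- Let $F \subseteq \mathbb{N}$ be a finite set such that either $F = \emptyset$ or $\min F \geq 3$, and assume moreover that $2 \notin F$, $5 \notin F$ and $10 \notin F$. Then for every odd integer $n \geq 5$ we have $Q_{U(F,n)} \geq \frac{5}{3}$. In particular, $Q_{U(\emptyset,n)} \geq \frac{5}{3}$ for every odd $n \geq 5$.
   Context: For a nonzero integer $N$, $\mathrm{rad}(N)$ denotes the largest square-free positive divisor of $N$. For $a = (a_1,\ldots,a_n) \in \mathbb{Z}^n$ with all $a_i \neq 0$, the quality of $a$ is $q(a) = \frac{\log(\max\{|a_1|,\ldots,|a_n|\})}{\log \mathrm{rad}(a_1 \cdots a_n)}$. For a set $A$ of such $n$-tuples, $Q_A$ denotes the limit superior of $q(a)$ over $a \in A$ (i.e. the limsup of $q(a^{(k)})$ along an enumeration $a^{(1)}, a^{(2)}, \ldots$ of $A$; equivalently $\inf_{S \subseteq A \text{ finite}} \sup_{a \in A \setminus S} q(a)$). For $n \geq 3$ and a finite set $F \subseteq \mathbb{N}$ (with $\min F \geq 3$ if $F \neq \emptyset$), $U(F,n)$ is the set of all $(a_1,\ldots,a_n) \in \mathbb{Z}^n$ such that: (i) $\gcd(a_i,a_j) = 1$ for all $1 \leq i < j \leq n$; (ii) $a_1 + \cdots + a_n = 0$; (iii) there are no $b_1,\ldots,b_n \in \{ -1,0,1\}$ and indices $i,j \in \{1,\ldots,n\}$ with $b_i = 0$, $b_j = 1$ and $\sum_{k=1}^n b_k a_k = 0$; (iv) none of $a_1,\ldots,a_n$ is a multiple of any element of $F$.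 (Condition (iii) forces all $a_i \neq 0$.) -}

module Defs where

open import Data.Nat as ℕ using (ℕ; _^_; _<_; _≤_; _⊔_)
open import Data.Nat.Divisibility using (_∣_)
open import Data.Nat.Coprimality using (Coprime)
open import Data.Integer as ℤ using (ℤ; ∣_∣; +_; -[1+_])
import Data.Integer.Divisibility as ℤD
open import Data.Fin using (Fin)
open import Data.Vec.Functional using (Vector; foldr)
open import Data.List using (List)
open import Data.List.Membership.Propositional using (_∈_)
open import Data.Product using (Σ; ∃; ∃-syntax; _×_)
open import Data.Sum using (_⊎_)
open import Relation.Binary.PropositionalEquality using (_≡_; _≢_)
open import Relation.Nullary using (¬_)

Tuple : ℕ → Set
Tuple n = Fin n → ℤ

sumℤ : ∀ {n} → Tuple n → ℤ
sumℤ a = foldr ℤ._+_ (+ 0) a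

prodℤ : ∀ {n} → Tuple n → ℤ
prodℤ a = foldr ℤ._*_ (+ 1) a

maxAbs : ∀ {n} → Tuple n → ℕ
maxAbs a = foldr (λ x m → ∣ x ∣ ⊔ m) 0 a

SquareFree : ℕ → Set
SquareFree d = ∀ m → (m ℕ.* m) ∣ d → m ≡ 1

IsRad : ℕ → ℕ → Set
IsRad N R = (1 ≤ R) × SquareFree R × R ∣ N ×
            (∀ d → 1 ≤ d → SquareFree d → d ∣ N → d ≤ R)

IsSign : ℤ → Set
IsSign x = (x ≡ -[1+ 0 ]) ⊎ (x ≡ + 0) ⊎ (x ≡ + 1)

InU : List ℕ → (n : ℕ) → Tuple n → Set
InU F n a =
  (∀ i j → i ≢ j → Coprime ∣ a i ∣ ∣ a j ∣) ×
  (sumℤ a ≡ + 0) ×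
  (¬ (Σ (Tuple n) λ b → (∀ k → IsSign (b k)) ×
        (∃[ i ] b i ≡ + 0) × (∃[ j ] b j ≡ + 1) ×
        sumℤ (λ k → b k ℤ.* a k) ≡ + 0)) ×
  (∀ f → f ∈ F → ∀ i → ¬ ((+ f) ℤD.∣ a i))

-- q(a) > p / r  (for r > 0), i.e. log max|a_i| / log rad(a_1⋯a_n) > p/r,
-- expressed as rad(a_1⋯a_n)^p < (max|a_i|)^r
QualityAbove : ∀ {n} → Tuple n → ℕ → ℕ → Set
QualityAbove a p r = ∃[ R ] IsRad ∣ prodℤ a ∣ R × R ^ p < maxAbs a ^ r

Differs : ∀ {n} → Tuple n → Tuple n → Set
Differs a s = ∃[ i ] a i ≢ s i

{-# OPTIONS --safe #-}

-- If 10 ∣ x, then the three large terms of (x+1)⁵ - (x-1)⁵ - 10(x²+1)² + 8 = 0 are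
-- pairwise coprime.  If x solves the Pell equation x² - Dy² = 1, then the radical of
-- the product of the large terms divides 10Dy(x²+1), hence is O(x³), while the maximum
-- exceeds x⁵; this gives 5/3. Taking D = N² - 1 and the odd powers of N + √D makes N
-- divide x, so x ± 1 and x² + 1 are coprime to every number fixed in advance; an
-- element of F can then only divide 10(x²+1)² by dividing 10. For the remaining terms,
-- 8 is written as c₁ + ⋯ + cₖ - v with pairwise coprime terms that are coprime to the
-- elements of F and grow so fast that no signed subsum vanishes.  The starting point is
-- 8 = (1 + t) - (t - 7) with t divisible by every prime of F other than 7 and t ≡ 1
-- modulo 7.
module Submission where

open import Defs
open import Data.Nat
open import Data.Nat.Coprimality as Coprimality using (Coprime; coprime-divisor; coprime-/gcd)
open import Data.Nat.Divisibility
open import Data.Nat.DivMod using (_divMod_; result; m/n*n≡m)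
open import Data.Nat.GCD using (gcd; gcd[m,n]∣m; gcd[m,n]∣n; gcd[m,n]≢0)
open import Data.Nat.Induction using (<-rec)
open import Data.Nat.ListAction using (sum; product)
open import Data.Nat.ListAction.Properties using (∈⇒∣product; product≢0)
open import Data.Nat.Properties
open import Data.Nat.Solver using (module +-*-Solver)
open import Data.Nat.Tactic.RingSolver using (solve-∀)
open import Data.Integer as ℤ using (ℤ; +_; ∣_∣)
import Data.Integer.Properties as ℤₚ
import Data.Integer.Tactic.RingSolver as ℤSolver
open import Data.Fin using (Fin; zero; suc)
open import Data.Fin.Patterns using (0F; 1F; 2F; 3F; 4F; 5F; 6F)
open import Data.List as List using (List; map)
open import Data.List.Membership.Propositional using (_∈_; _∉_)
open import Data.List.Relation.Unary.All as All using (All)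
open import Data.Product using (Σ; ∃; ∃-syntax; _×_; _,_; proj₁; proj₂)
open import Data.Sum using (_⊎_; inj₁; inj₂; [_,_]′)
open import Data.Unit using (⊤; tt)
open import Data.Vec.Functional using (Vector; foldr; head; tail; []; _∷_)
open import Function using (_∘_)
open import Relation.Nullary using (¬_; yes; no; ¬?; contradiction)
open import Relation.Nullary.Decidable using (_×-dec_; from-no)
open import Relation.Binary.PropositionalEquality

-- Coprimality of products, powers and neighbours.

coprime-* : ∀ {a b c} → Coprime a b → Coprime a c → Coprime a (b * c)
coprime-* ab ac (d∣a , d∣bc) = ac (d∣a , coprime-divisor d⊥b d∣bc)
  where
  d⊥b : Coprime _ _
  d⊥b (e∣d , e∣b) = ab (∣-trans e∣d d∣a , e∣b)

coprime-^ : ∀ {a b} → Coprime a b → ∀ n → Coprime a (b ^ n)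
coprime-^ ab zero    (_ , d∣1) = ∣1⇒≡1 d∣1
coprime-^ ab (suc n) = coprime-* ab (coprime-^ ab n)

coprime-∣ : ∀ {a b c} → Coprime a b → c ∣ b → Coprime a c
coprime-∣ ab c∣b (d∣a , d∣c) = ab (d∣a , ∣-trans d∣c c∣b)

suc-coprime : ∀ {m t} → m ∣ t → Coprime (suc t) m
suc-coprime {t = t} m∣t {d} (d∣1+t , d∣m) =
  ∣1⇒≡1 (∣m+n∣m⇒∣n (subst (d ∣_) (+-comm 1 t) d∣1+t) (∣-trans d∣m m∣t))

pred-coprime : ∀ {m e} → m ∣ suc e → Coprime e m
pred-coprime {e = e} m∣1+e {d} (d∣e , d∣m) =
  ∣1⇒≡1 (∣m+n∣m⇒∣n (subst (d ∣_) (+-comm 1 e) (∣-trans d∣m m∣1+e)) d∣e)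

-- Squarefree divisors and the radical.

squareFree⇒>0 : ∀ {d} → SquareFree d → 0 < d
squareFree⇒>0 {zero}  sf = contradiction (sf 2 (_ ∣0)) λ ()
squareFree⇒>0 {suc d} sf = z<s

-- With g = gcd d m, the cofactor r = d / g divides g, so r * r divides d.
squareFree-∣² : ∀ {d m} → SquareFree d → d ∣ m * m → d ∣ m
squareFree-∣² {d} {m} sf d∣m² = subst (_∣ m) (sym d≡g) (gcd[m,n]∣n d m)
  where
  g = gcd d m
  instance
    d≢0 : NonZero d
    d≢0 = >-nonZero (squareFree⇒>0 sf)
    g≢0 : NonZero g
    g≢0 = ≢-nonZero (gcd[m,n]≢0 d m (inj₁ (≢-nonZero⁻¹ d)))
  r = d / g
  c = m / g
  r⊥c : Coprime r c
  r⊥c = coprime-/gcd d m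
  d≡gr : d ≡ g * r
  d≡gr = trans (sym (m/n*n≡m (gcd[m,n]∣m d m))) (*-comm r g)
  m≡gc : m ≡ g * c
  m≡gc = trans (sym (m/n*n≡m (gcd[m,n]∣n d m))) (*-comm c g)
  regroup : ∀ g c → (g * c) * (g * c) ≡ g * (c * (c * g))
  regroup = solve-∀
  r∣g : r ∣ g
  r∣g = coprime-divisor r⊥c (coprime-divisor r⊥c (*-cancelˡ-∣ g
    (subst₂ _∣_ d≡gr (trans (cong₂ _*_ m≡gc m≡gc) (regroup g c)) d∣m²)))
  d≡g : d ≡ g
  d≡g = begin
    d      ≡⟨ d≡gr ⟩
    g * r  ≡⟨ cong (g *_) (sf r (subst (r * r ∣_) (sym d≡gr) (*-monoˡ-∣ r r∣g))) ⟩
    g * 1  ≡⟨ *-identityʳ g ⟩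
    g      ∎
    where open ≡-Reasoning

-- The exponent drops by one at a time: m^(n+2) divides the square of m^(n+1), so `squareFree-∣²`
-- applies.
squareFree-∣^ : ∀ {d m} → SquareFree d → ∀ n → d ∣ m ^ suc n → d ∣ m
squareFree-∣^ {d} {m} sf zero    d∣ = subst (d ∣_) (*-identityʳ m) d∣
squareFree-∣^ {d} {m} sf (suc n) d∣ = squareFree-∣^ sf n
  (squareFree-∣² sf (subst (d ∣_) (regroup m (m ^ n)) (∣m⇒∣m*n (m ^ n) d∣)))
  where
  regroup : ∀ m k → m * (m * k) * k ≡ (m * k) * (m * k)
  regroup = solve-∀

-- If `m * m` divides `N` with `m ≢ 1`, then N = q m² is replaced by the smaller q m. A squarefree
-- divisor of `N` divides q N = (q m)², hence q m, so none is lost.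
rad-exists : ∀ N → 0 < N → ∃ (IsRad N)
rad-exists N N>0 = let R , sf , R∣N , max = <-rec Rad step N N>0 in
  R , squareFree⇒>0 sf , sf , R∣N ,
  λ d _ sfd d∣N → ∣⇒≤ {{>-nonZero (squareFree⇒>0 sf)}} (max d sfd d∣N)
  where
  Rad : ℕ → Set
  Rad N = 0 < N → ∃[ R ] SquareFree R × R ∣ N × (∀ d → SquareFree d → d ∣ N → d ∣ R)

  step : ∀ N → (∀ {M} → M < N → Rad M) → Rad N
  step N rec N>0
    -- A square `m * m` dividing a positive `N` has `m ≤ N`, so a finite search decides.
    with anyUpTo? (λ m → ¬? (m ≟ 1) ×-dec (m * m ∣? N)) (suc N)
  ... | no none = N , sf , ∣-refl , λ _ _ d∣N → d∣N
    where
    sf : SquareFree N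
    sf m m²∣N with m ≟ 1
    ... | yes m≡1 = m≡1
    ... | no m≢1 = contradiction
      (m , s≤s (∣⇒≤ {{>-nonZero N>0}} (∣-trans (m∣m*n m) m²∣N)) , m≢1 , m²∣N) none
  ... | yes (0 , _ , _ , divides q N≡) =
    contradiction (subst (0 <_) (trans N≡ (*-zeroʳ q)) N>0) λ ()
  ... | yes (1 , _ , m≢1 , _) = contradiction refl m≢1
  ... | yes (m@(suc (suc _)) , _ , _ , divides zero N≡) =
    contradiction (subst (0 <_) N≡ N>0) λ ()
  ... | yes (m@(suc (suc _)) , _ , _ , divides q@(suc _) N≡) =
    let R , sf , R∣ , max = rec smaller (>-nonZero⁻¹ (q * m)) in
    R , sf , ∣-trans R∣ (divides m (trans N≡q*m*m (*-comm (q * m) m))) ,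
    λ d sfd d∣N → max d sfd (squareFree-∣² sfd
      (subst (d ∣_) (regroup q m) (∣m⇒∣m*n q (subst (d ∣_) N≡q*m*m d∣N))))
    where
    N≡q*m*m : N ≡ q * m * m
    N≡q*m*m = trans N≡ (sym (*-assoc q m m))
    smaller : q * m < N
    smaller = subst (q * m <_) (sym N≡q*m*m) (m<m*n (q * m) m (s≤s (s≤s z≤n)))
    regroup : ∀ q m → q * m * m * q ≡ (q * m) * (q * m)
    regroup = solve-∀

-- Solutions of the Pell equation.

-- The iterates are the odd powers of N + √D, which keep x divisible by N.
pell : ∀ {N D} → 0 < N → 0 < D → N * N ≡ suc D → ∀ B →
       ∃[ x ] ∃[ y ] x * x ≡ suc (D * (y * y)) × N ∣ x × B < x
pell {N} {D} N>0 D>0 N²≡ zero    =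
  N , 1 , trans N²≡ (cong suc (sym (*-identityʳ D))) , ∣-refl , N>0
pell {N} {D} N>0 D>0 N²≡ (suc B) with pell N>0 D>0 N²≡ B
... | x , y , x²≡ , N∣x , B<x = x′ , y′ , x′²≡ , N∣x′ , ≤-trans (s≤s B<x) x<x′
  where
  -- Multiplication of x + y√D by (N + √D)², which is (2D + 1) + 2N√D because N² = D + 1.
  x′ = suc (D + D) * x + N * (2 * D * y)
  y′ = 2 * N * x + suc (D + D) * y
  -- The common shape of both sides of the new equation: they differ only by exchanging N² with D +
  -- 1 and x² with 1 + Dy².
  expand : ℕ → ℕ → ℕ → ℕ
  expand p q s = s + 4 * D * p * (x * x) + 4 * N * D * suc (D + D) * x * y + 4 * D * D * q * (y * y)
  expand-x′ : ∀ N D x y →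
    let x′ = suc (D + D) * x + N * (2 * D * y) in
    x′ * x′ ≡ x * x + 4 * D * suc D * (x * x)
      + 4 * N * D * suc (D + D) * x * y + 4 * D * D * (N * N) * (y * y)
  expand-x′ = solve-∀
  expand-y′ : ∀ N D x y →
    let y′ = 2 * N * x + suc (D + D) * y in
    suc (D * (y′ * y′)) ≡ suc (D * (y * y)) + 4 * D * (N * N) * (x * x)
      + 4 * N * D * suc (D + D) * x * y + 4 * D * D * suc D * (y * y)
  expand-y′ = solve-∀
  x′²≡ : x′ * x′ ≡ suc (D * (y′ * y′))
  x′²≡ = begin
    x′ * x′                              ≡⟨ expand-x′ N D x y ⟩
    expand (suc D) (N * N) (x * x)       ≡⟨ cong₂ (λ p q → expand p q (x * x)) (sym N²≡) N²≡ ⟩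
    expand (N * N) (suc D) (x * x)       ≡⟨ cong (expand (N * N) (suc D)) x²≡ ⟩
    expand (N * N) (suc D) (suc (D * (y * y)))  ≡⟨ expand-y′ N D x y ⟨
    suc (D * (y′ * y′))                  ∎
    where open ≡-Reasoning
  N∣x′ : N ∣ x′
  N∣x′ = ∣m∣n⇒∣m+n (∣n⇒∣m*n (suc (D + D)) N∣x) (m∣m*n (2 * D * y))
  x<x′ : x < x′
  x<x′ = begin-strict
    x                   ≡⟨ +-identityʳ x ⟨
    x + 0               <⟨ +-monoʳ-< x (*-mono-≤ (≤-trans D>0 (m≤m+n D D)) (≤-trans (s≤s z≤n) B<x)) ⟩
    x + (D + D) * x     ≤⟨ m≤m+n _ _ ⟩
    x′                  ∎
    where open ≤-Reasoning

-- Splitting the constant 8 into coprime terms.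

-- Factors 7 of `K` are moved into `7 ^ a`; what remains is prime to 7 and is multiplied by an
-- inverse of its residue modulo 7.
multiple-≡1-mod-7 : ∀ K → 0 < K → ∃[ a ] ∃[ t ] ∃[ k ] K ∣ 7 ^ a * t × t ≡ suc (7 * k)
multiple-≡1-mod-7 = <-rec _ step
  where
  Goal : ℕ → Set
  Goal K = ∃[ a ] ∃[ t ] ∃[ k ] K ∣ 7 ^ a * t × t ≡ suc (7 * k)

  -- Here `s` is the inverse of the residue `r` modulo 7.
  unit : ∀ r q s k → r * s ≡ suc (7 * k) → Goal (r + q * 7)
  unit r q s k rs≡ = 0 , (r + q * 7) * s , k + q * s ,
    subst (r + q * 7 ∣_) (sym (*-identityˡ _)) (m∣m*n s) ,
    trans (expand r q s) (trans (cong (_+ 7 * (q * s)) rs≡) (cong suc (sym (*-distribˡ-+ 7 k (q * s)))))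
    where
    expand : ∀ r q s → (r + q * 7) * s ≡ r * s + 7 * (q * s)
    expand = solve-∀

  step : ∀ K → (∀ {M} → M < K → 0 < M → Goal M) → 0 < K → Goal K
  step K rec K>0 with K divMod 7
  ... | result zero    0F refl = contradiction K>0 λ ()
  ... | result q@(suc _) 0F refl =
    let a , t , k , q∣ , t≡ = rec (m<m*n q 7 (s≤s (s≤s z≤n))) z<s in
    suc a , t , k , subst₂ _∣_ (*-comm 7 q) (sym (*-assoc 7 (7 ^ a) t)) (*-monoʳ-∣ 7 q∣) , t≡
  ... | result q 1F refl = unit 1 q 1 0 refl
  ... | result q 2F refl = unit 2 q 4 1 refl
  ... | result q 3F refl = unit 3 q 5 2 refl
  ... | result q 4F refl = unit 4 q 2 1 refl
  ... | result q 5F refl = unit 5 q 3 2 refl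
  ... | result q 6F refl = unit 6 q 6 5 refl

*-pos : ∀ {m n} → 0 < m → 0 < n → 0 < m * n
*-pos = *-mono-≤

total : ∀ {k} → Vector ℕ k → ℕ
total = foldr _+_ 0

PairwiseCoprime : ∀ {k} → Vector ℕ k → Set
PairwiseCoprime c = ∀ i j → i ≢ j → Coprime (c i) (c j)

pairwise-∷ : ∀ {k d} {c : Vector ℕ k} → (∀ i → Coprime d (c i)) →
             PairwiseCoprime c → PairwiseCoprime (d ∷ c)
pairwise-∷ d⊥c c⊥c zero    zero    i≢j = contradiction refl i≢j
pairwise-∷ d⊥c c⊥c zero    (suc j) _   = d⊥c j
pairwise-∷ d⊥c c⊥c (suc i) zero    _   = Coprimality.sym (d⊥c i)
pairwise-∷ d⊥c c⊥c (suc i) (suc j) i≢j = c⊥c i j (i≢j ∘ cong suc)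

-- The factor 2 allows for coefficients that are differences of two signs; the slack 16 is 8 times
-- the largest such difference.
SuperDecreasing : ∀ {k} → Vector ℕ k → Set
SuperDecreasing {zero}  c = ⊤
SuperDecreasing {suc k} c = 2 * total (tail c) + 16 < head c × SuperDecreasing (tail c)

-- The constant 8 written as the sum of k pairwise coprime positive numbers c i
-- and one negative number - (2 + w); the modulus records everything that later
-- constants have to avoid.
record Splitting (G k : ℕ) : Set where
  field
    c               : Vector ℕ k
    w               : ℕ
    modulus         : ℕ
    modulus>0       : 0 < modulus
    G∣modulus       : G ∣ modulus
    c∣modulus       : ∀ i → c i ∣ modulus
    c⊥G             : ∀ i → Coprime (c i) G
    c⊥c             : PairwiseCoprime c
    residue⊥modulus : Coprime (2 + w) modulus
    decreasing      : SuperDecreasing c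
    balance         : total c ≡ 8 + (2 + w)

-- With w = t - 9 the residue is t - 7. A common divisor with t divides 7, which t ≡ 1 modulo 7
-- excludes; one with t + 1 divides 8, hence t, hence is 1. Finally t + 1 ≡ 2 modulo 7 is prime to
-- 7.
base : ∀ a {t k} → 64 ≤ t → 8 ∣ t → t ≡ suc (7 * k) → Splitting (7 ^ a * t) 1
base a {t} {k} 64≤t 8∣t t≡ with m≤n⇒∃[o]m+o≡n (≤-trans (m≤m+n 9 55) 64≤t)
... | w , refl = record
  { c               = suc t ∷ []
  ; w               = w
  ; modulus         = suc t * (7 ^ a * t)
  ; modulus>0       = *-pos {suc t} z<s (*-pos {n = t} (m^n>0 7 a) z<s)
  ; G∣modulus       = n∣m*n (suc t)
  ; c∣modulus       = λ { 0F → m∣m*n (7 ^ a * t) }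
  ; c⊥G             = λ { 0F → coprime-* (coprime-^ u⊥7 a) u⊥t }
  ; c⊥c             = λ { 0F 0F i≢i → contradiction refl i≢i }
  ; residue⊥modulus = coprime-* v⊥u (coprime-* (coprime-^ v⊥7 a) v⊥t)
  ; decreasing      = ≤-trans (m≤m+n 17 47) (≤-trans 64≤t (n≤1+n t)) , tt
  ; balance         = +-identityʳ (suc t)
  }
  where
  v = 2 + w
  u⊥t : Coprime (suc t) t
  u⊥t = suc-coprime ∣-refl
  t⊥7 : Coprime t 7
  t⊥7 = subst (λ t → Coprime t 7) (sym t≡) (suc-coprime (m∣m*n k))
  u⊥7 : Coprime (suc t) 7
  u⊥7 {d} (d∣u , d∣7) = pred-coprime {m = 2} {e = 7} (divides 4 refl)
    (d∣7 , ∣m+n∣m⇒∣n (subst (d ∣_) (trans (cong suc t≡) (+-comm 2 (7 * k))) d∣u) (∣m⇒∣m*n k d∣7))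
  v⊥t : Coprime v t
  v⊥t {d} (d∣v , d∣t) = t⊥7 (d∣t , ∣m+n∣m⇒∣n (subst (d ∣_) (+-comm 7 v) d∣t) d∣v)
  v⊥7 : Coprime v 7
  v⊥7 (d∣v , d∣7) = t⊥7 (∣m∣n⇒∣m+n d∣7 d∣v , d∣7)
  v⊥u : Coprime v (suc t)
  v⊥u {d} (d∣v , d∣u) = u⊥t
    (d∣u , ∣-trans (∣m+n∣m⇒∣n (subst (d ∣_) (+-comm 8 v) d∣u) d∣v) 8∣t)

-- Modulo the old modulus d ≡ 1 and e ≡ -1, so the residue keeps its class;
-- the further factors of T and of U make it coprime to d and to e as well.
extend : ∀ {G k} → Splitting G k → Splitting G (2 + k)
extend {G} σ = record
  { c               = e ∷ d ∷ c
  ; w               = w + (d + e)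
  ; modulus         = W * (d * e)
  ; modulus>0       = *-pos {W} modulus>0 (*-pos {d} {e} z<s e>0)
  ; G∣modulus       = ∣m⇒∣m*n (d * e) G∣modulus
  ; c∣modulus       = λ { zero → ∣n⇒∣m*n W (n∣m*n d)
                        ; (suc zero) → ∣n⇒∣m*n W (m∣m*n e)
                        ; (suc (suc i)) → ∣m⇒∣m*n (d * e) (c∣modulus i) }
  ; c⊥G             = λ { zero → coprime-∣ e⊥W G∣modulus
                        ; (suc zero) → coprime-∣ d⊥W G∣modulus
                        ; (suc (suc i)) → c⊥G i }
  ; c⊥c             = pairwise-∷ (λ { zero → e⊥d ; (suc i) → coprime-∣ e⊥W (c∣modulus i) })
                        (pairwise-∷ (λ i → coprime-∣ d⊥W (c∣modulus i)) c⊥c)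
  ; residue⊥modulus = coprime-* v′⊥W (coprime-* v′⊥d v′⊥e)
  ; decreasing      = e-large , d-large , decreasing
  ; balance         = trans (cong (λ s → e + (d + s)) balance) (regroup e d w)
  }
  where
  open Splitting σ
  W = modulus
  S = total c
  v = 2 + w
  -- Modulo `d` the new residue is `suc w`, which divides d - 1 = T. The last factor makes `d`
  -- exceed the bound in `SuperDecreasing`.
  T = W * (suc w * (2 * S + 16))
  d = suc T
  bound = 2 * (d + S) + 16
  -- Modulo `e` the new residue is `v + d`, which divides e + 1 = U. The factor `2 + bound`, rather
  -- than `1 + bound`, makes up for the predecessor in `e`.
  U = W * (d * ((v + d) * (2 + bound)))
  e = pred U
  v′ = v + (d + e)
  U>0 : 0 < U
  U>0 = *-pos {W} modulus>0 (*-pos {d} z<s (*-pos {v + d} {2 + bound} z<s z<s))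
  suc-e : suc e ≡ U
  suc-e = suc-pred U {{>-nonZero U>0}}
  W∣T : W ∣ T
  W∣T = m∣m*n _
  W∣U : W ∣ U
  W∣U = m∣m*n _
  d∣U : d ∣ U
  d∣U = ∣n⇒∣m*n W (m∣m*n _)
  e⊥ : ∀ {m} → m ∣ U → Coprime e m
  e⊥ {m} m∣U = pred-coprime (subst (m ∣_) (sym suc-e) m∣U)
  d⊥W : Coprime d W
  d⊥W = suc-coprime W∣T
  e⊥W : Coprime e W
  e⊥W = e⊥ W∣U
  e⊥d : Coprime e d
  e⊥d = e⊥ d∣U
  regroup : ∀ e d w → e + (d + (8 + (2 + w))) ≡ 8 + (2 + (w + (d + e)))
  regroup = solve-∀
  v′-mod-W : v′ ≡ (T + U) + v
  v′-mod-W = begin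
    v + (d + e)      ≡⟨ cong (λ s → v + s) (sym (+-suc T e)) ⟩
    v + (T + suc e)  ≡⟨ cong (λ s → v + (T + s)) suc-e ⟩
    v + (T + U)      ≡⟨ +-comm v (T + U) ⟩
    (T + U) + v      ∎
    where open ≡-Reasoning
  v′-mod-d : v′ ≡ (d + U) + suc w
  v′-mod-d = trans (lemma w d e) (cong (λ s → (d + s) + suc w) suc-e)
    where
    lemma : ∀ w d e → 2 + w + (d + e) ≡ (d + suc e) + suc w
    lemma = solve-∀
  v′-mod-e : v′ ≡ e + (v + d)
  v′-mod-e = lemma v d e
    where
    lemma : ∀ v d e → v + (d + e) ≡ e + (v + d)
    lemma = solve-∀
  v′⊥W : Coprime v′ W
  v′⊥W {q} (q∣v′ , q∣W) = residue⊥modulus (∣m+n∣m⇒∣n (subst (q ∣_) v′-mod-W q∣v′)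
    (∣m∣n⇒∣m+n (∣-trans q∣W W∣T) (∣-trans q∣W W∣U)) , q∣W)
  v′⊥d : Coprime v′ d
  v′⊥d {q} (q∣v′ , q∣d) = suc-coprime {suc w} {T} (∣n⇒∣m*n W (m∣m*n _)) (q∣d ,
    ∣m+n∣m⇒∣n (subst (q ∣_) v′-mod-d q∣v′) (∣m∣n⇒∣m+n q∣d (∣-trans q∣d d∣U)))
  v′⊥e : Coprime v′ e
  v′⊥e {q} (q∣v′ , q∣e) = e⊥ {v + d} (∣n⇒∣m*n W (∣n⇒∣m*n d (m∣m*n {v + d} (2 + bound)))) (q∣e ,
    ∣m+n∣m⇒∣n (subst (q ∣_) v′-mod-e q∣v′) q∣e)
  d-large : 2 * S + 16 < d
  d-large = s≤s (≤-trans (m≤n*m (2 * S + 16) (suc w)) (m≤n*m _ W {{>-nonZero modulus>0}}))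
  e-large : bound < e
  e-large = s≤s⁻¹ (subst (2 + bound ≤_) (sym suc-e)
    (≤-trans (m≤n*m (2 + bound) (v + d)) (≤-trans (m≤n*m ((v + d) * (2 + bound)) d)
      (m≤n*m (d * ((v + d) * (2 + bound))) W {{>-nonZero modulus>0}}))))
  e>0 : 0 < e
  e>0 = ≤-trans (s≤s z≤n) e-large

-- Each extension adds two terms, so the number of positive terms stays odd; this is where the
-- parity of the tuple length comes from.
splitting : ∀ a {t k} → 64 ≤ t → 8 ∣ t → t ≡ suc (7 * k) →
            ∀ h → Splitting (7 ^ a * t) (suc (h * 2))
splitting a {k = k} 64≤t 8∣t t≡ zero    = base a {k = k} 64≤t 8∣t t≡
splitting a {k = k} 64≤t 8∣t t≡ (suc h) = extend (splitting a {k = k} 64≤t 8∣t t≡ h)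

-- Signed sums over rapidly growing sequences.

-- A nonzero multiple of `d` has absolute value at least `d`, too large to be cancelled by `E`.
cancel-dominant : ∀ {d} δ E → ∣ E ∣ < d → δ ℤ.* + d ℤ.+ E ≡ + 0 → δ ≡ + 0 × E ≡ + 0
cancel-dominant {d} δ E E<d eq with ∣ δ ∣ ≟ 0
... | yes ∣δ∣≡0 = δ≡0 , (begin
    E                     ≡⟨ ℤₚ.+-identityˡ E ⟨
    + 0 ℤ.* + d ℤ.+ E     ≡⟨ cong (λ δ → δ ℤ.* + d ℤ.+ E) δ≡0 ⟨
    δ ℤ.* + d ℤ.+ E       ≡⟨ eq ⟩
    + 0                   ∎)
  where
  open ≡-Reasoning
  δ≡0 = ℤₚ.∣i∣≡0⇒i≡0 ∣δ∣≡0
... | no ∣δ∣≢0 = contradiction E<d (≤⇒≯ (begin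
    d                     ≤⟨ m≤n*m d ∣ δ ∣ {{≢-nonZero ∣δ∣≢0}} ⟩
    ∣ δ ∣ * d             ≡⟨ ℤₚ.abs-* δ (+ d) ⟨
    ∣ δ ℤ.* + d ∣         ≡⟨ cong ∣_∣ (isolate (δ ℤ.* + d) E) ⟩
    ∣ (δ ℤ.* + d ℤ.+ E) ℤ.- E ∣  ≡⟨ cong (λ z → ∣ z ℤ.- E ∣) eq ⟩
    ∣ + 0 ℤ.- E ∣         ≡⟨ cong ∣_∣ (ℤₚ.+-identityˡ (ℤ.- E)) ⟩
    ∣ ℤ.- E ∣             ≡⟨ ℤₚ.∣-i∣≡∣i∣ E ⟩
    ∣ E ∣                 ∎))
  where
  open ≤-Reasoning
  isolate : ∀ x e → x ≡ (x ℤ.+ e) ℤ.- e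
  isolate = ℤSolver.solve-∀

infix 7 _·_
_·_ : ∀ {k} → Tuple k → Vector ℕ k → ℤ
b · c = sumℤ (λ i → b i ℤ.* + c i)

∣*∣-≤ : ∀ δ n → ∣ δ ∣ ≤ 2 → ∣ δ ℤ.* + n ∣ ≤ 2 * n
∣*∣-≤ δ n δ≤2 = subst (_≤ 2 * n) (sym (ℤₚ.abs-* δ (+ n))) (*-monoˡ-≤ n δ≤2)

∣·∣-≤ : ∀ {k} (δ : Tuple k) (c : Vector ℕ k) → (∀ i → ∣ δ i ∣ ≤ 2) → ∣ δ · c ∣ ≤ 2 * total c
∣·∣-≤ {zero}  δ c δ≤2 = z≤n
∣·∣-≤ {suc k} δ c δ≤2 = begin
  ∣ δ 0F ℤ.* + c 0F ℤ.+ tail δ · tail c ∣      ≤⟨ ℤₚ.∣i+j∣≤∣i∣+∣j∣ (δ 0F ℤ.* + c 0F) _ ⟩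
  ∣ δ 0F ℤ.* + c 0F ∣ + ∣ tail δ · tail c ∣
    ≤⟨ +-mono-≤ (∣*∣-≤ (δ 0F) (c 0F) (δ≤2 0F)) (∣·∣-≤ (tail δ) (tail c) (δ≤2 ∘ suc)) ⟩
  2 * c 0F + 2 * total (tail c)                ≡⟨ *-distribˡ-+ 2 (c 0F) _ ⟨
  2 * total c                                  ∎
  where open ≤-Reasoning

-- Serves to eliminate the residue v = total c - 8: its coefficient gets subtracted from that of
-- every `c i`.
·-shift : ∀ {k} (b : Tuple k) (c : Vector ℕ k) s →
          (λ i → b i ℤ.- s) · c ≡ b · c ℤ.- s ℤ.* + total c
·-shift {zero}  b c s = sym (cong (λ z → + 0 ℤ.- z) (ℤₚ.*-zeroʳ s))
·-shift {suc k} b c s = begin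
  (b 0F ℤ.- s) ℤ.* + c 0F ℤ.+ (λ i → b (suc i) ℤ.- s) · tail c
    ≡⟨ cong (λ z → (b 0F ℤ.- s) ℤ.* + c 0F ℤ.+ z) (·-shift (tail b) (tail c) s) ⟩
  (b 0F ℤ.- s) ℤ.* + c 0F ℤ.+ (tail b · tail c ℤ.- s ℤ.* + total (tail c))
    ≡⟨ regroup (b 0F) s (+ c 0F) (tail b · tail c) (+ total (tail c)) ⟩
  b · c ℤ.- s ℤ.* + total c  ∎
  where
  open ≡-Reasoning
  regroup : ∀ b s c B t → (b ℤ.- s) ℤ.* c ℤ.+ (B ℤ.- s ℤ.* t) ≡ (b ℤ.* c ℤ.+ B) ℤ.- s ℤ.* (c ℤ.+ t)
  regroup = ℤSolver.solve-∀

-- The head dominates everything after it, including `ε`, so `cancel-dominant` removes the terms one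
-- by one.
superDecreasing⇒independent : ∀ {k} (δ : Tuple k) (c : Vector ℕ k) ε → SuperDecreasing c →
  (∀ i → ∣ δ i ∣ ≤ 2) → ∣ ε ∣ ≤ 16 → δ · c ℤ.+ ε ≡ + 0 → (∀ i → δ i ≡ + 0) × ε ≡ + 0
superDecreasing⇒independent {zero}  δ c ε _ _ _ eq = (λ ()) , trans (sym (ℤₚ.+-identityˡ ε)) eq
superDecreasing⇒independent {suc k} δ c ε (big , dec) δ≤2 ε≤16 eq =
  let δ₀≡0 , rest≡0 = cancel-dominant (δ 0F) (tail δ · tail c ℤ.+ ε) small
                        (trans (sym (ℤₚ.+-assoc (δ 0F ℤ.* + c 0F) _ ε)) eq)
      δ≡0 , ε≡0 = superDecreasing⇒independent (tail δ) (tail c) ε dec (δ≤2 ∘ suc) ε≤16 rest≡0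
  in (λ { zero → δ₀≡0 ; (suc i) → δ≡0 i }) , ε≡0
  where
  small : ∣ tail δ · tail c ℤ.+ ε ∣ < c 0F
  small = ≤-<-trans (ℤₚ.∣i+j∣≤∣i∣+∣j∣ (tail δ · tail c) ε)
    (≤-<-trans (+-mono-≤ (∣·∣-≤ (tail δ) (tail c) (δ≤2 ∘ suc)) ε≤16) big)

sign-difference : ∀ {x y} → IsSign x → IsSign y → ∣ x ℤ.- y ∣ ≤ 2
sign-difference (inj₁ refl)        (inj₁ refl)        = z≤n
sign-difference (inj₁ refl)        (inj₂ (inj₁ refl)) = s≤s z≤n
sign-difference (inj₁ refl)        (inj₂ (inj₂ refl)) = ≤-refl
sign-difference (inj₂ (inj₁ refl)) (inj₁ refl)        = s≤s z≤n
sign-difference (inj₂ (inj₁ refl)) (inj₂ (inj₁ refl)) = z≤n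
sign-difference (inj₂ (inj₁ refl)) (inj₂ (inj₂ refl)) = s≤s z≤n
sign-difference (inj₂ (inj₂ refl)) (inj₁ refl)        = ≤-refl
sign-difference (inj₂ (inj₂ refl)) (inj₂ (inj₁ refl)) = s≤s z≤n
sign-difference (inj₂ (inj₂ refl)) (inj₂ (inj₂ refl)) = z≤n

∣sign∣≤2 : ∀ {x} → IsSign x → ∣ x ∣ ≤ 2
∣sign∣≤2 (inj₁ refl)        = s≤s z≤n
∣sign∣≤2 (inj₂ (inj₁ refl)) = z≤n
∣sign∣≤2 (inj₂ (inj₂ refl)) = s≤s z≤n

-- Assembling the tuple and excluding signed subsums.

assemble : ∀ {k} → ℕ → ℕ → ℕ → ℕ → Vector ℕ k → Tuple (4 + k)
assemble α β γ v c = + α ∷ ℤ.- + β ∷ ℤ.- + γ ∷ ℤ.- + v ∷ (+_ ∘ c)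

module _ {k α β γ v : ℕ} {c : Vector ℕ k}
         (α+8≡β+γ : α + 8 ≡ β + γ) (balance : total c ≡ 8 + v) where

  private
    +α≡ : + α ≡ + β ℤ.+ + γ ℤ.- + 8
    +α≡ = trans (isolate (+ α) (+ 8)) (cong (λ s → + s ℤ.- + 8) α+8≡β+γ)
      where
      isolate : ∀ x y → x ≡ (x ℤ.+ y) ℤ.- y
      isolate = ℤSolver.solve-∀

    +v≡ : + v ≡ + total c ℤ.- + 8
    +v≡ = trans (isolate (+ v) (+ 8)) (cong (λ s → + s ℤ.- + 8) (sym balance))
      where
      isolate : ∀ x y → x ≡ (y ℤ.+ x) ℤ.- y
      isolate = ℤSolver.solve-∀

  -- The three large terms contribute -8 and the splitting contributes 8.
  assemble-sum : sumℤ (assemble α β γ v c) ≡ + 0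
  assemble-sum = begin
    + α ℤ.+ (ℤ.- + β ℤ.+ (ℤ.- + γ ℤ.+ (ℤ.- + v ℤ.+ sumℤ (+_ ∘ c))))
      ≡⟨ cong (λ s → + α ℤ.+ (ℤ.- + β ℤ.+ (ℤ.- + γ ℤ.+ (ℤ.- + v ℤ.+ s)))) (sum-+ c) ⟩
    + α ℤ.+ (ℤ.- + β ℤ.+ (ℤ.- + γ ℤ.+ (ℤ.- + v ℤ.+ + total c)))
      ≡⟨ cong₂ (λ a v → a ℤ.+ (ℤ.- + β ℤ.+ (ℤ.- + γ ℤ.+ (ℤ.- v ℤ.+ + total c)))) +α≡ +v≡ ⟩
    _ ≡⟨ cancel (+ β) (+ γ) (+ 8) (+ total c) ⟩
    + 0 ∎
    where
    open ≡-Reasoning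
    sum-+ : ∀ {k} (c : Vector ℕ k) → sumℤ (+_ ∘ c) ≡ + total c
    sum-+ {zero}  c = refl
    sum-+ {suc k} c = cong (λ z → + c 0F ℤ.+ z) (sum-+ (tail c))
    cancel : ∀ b g e s →
      (b ℤ.+ g ℤ.- e) ℤ.+ (ℤ.- b ℤ.+ (ℤ.- g ℤ.+ (ℤ.- (s ℤ.- e) ℤ.+ s))) ≡ + 0
    cancel = ℤSolver.solve-∀

  -- Eliminating the largest entry by α = β + γ - 8 and the residue by v = total c - 8
  -- leaves coefficient differences of size at most 2 on a superdecreasing sequence.
  assemble-rigid : SuperDecreasing c →
    2 * total c + 2 * v + 16 < γ → 2 * γ + (2 * total c + 2 * v + 16) < β →
    (b : Tuple (4 + k)) → (∀ i → IsSign (b i)) →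
    sumℤ (λ i → b i ℤ.* assemble α β γ v c i) ≡ + 0 → ∀ i → b i ≡ b 0F
  assemble-rigid dec γ-large β-large b sign eq =
    let b₀≡b₁ , eq₁ = cancel-dominant (b 0F ℤ.- b 1F) _ E₁-small (trans (sym eliminate) eq)
        b₀≡b₂ , eq₂ = cancel-dominant (b 0F ℤ.- b 2F) _ E₂-small eq₁
        bᵢ≡b₃ , ε≡0 = superDecreasing⇒independent (λ i → b (4+ i) ℤ.- b 3F) c ε dec
                        (λ i → sign-difference (sign (4+ i)) (sign 3F)) ε-small
                        (trans eliminate-v eq₂)
        b₃≡b₀ = ℤₚ.i-j≡0⇒i≡j (b 3F) (b 0F) (ℤₚ.*-cancelˡ-≡ (+ 8) _ _ ε≡0)
    in λ { 0F → refl
         ; 1F → sym (ℤₚ.i-j≡0⇒i≡j (b 0F) (b 1F) b₀≡b₁)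
         ; 2F → sym (ℤₚ.i-j≡0⇒i≡j (b 0F) (b 2F) b₀≡b₂)
         ; 3F → b₃≡b₀
         ; (suc (suc (suc (suc i)))) → trans (ℤₚ.i-j≡0⇒i≡j (b (4+ i)) (b 3F) (bᵢ≡b₃ i)) b₃≡b₀ }
    where
    4+_ : Fin k → Fin (4 + k)
    4+ i = suc (suc (suc (suc i)))
    Σbc = (λ i → b (4+ i)) · c
    E₂ = (Σbc ℤ.+ ℤ.- b 3F ℤ.* + v) ℤ.+ ℤ.- b 0F ℤ.* + 8
    E₁ = (b 0F ℤ.- b 2F) ℤ.* + γ ℤ.+ E₂
    -- Eliminating `α` leaves the constant -8 b₀ and eliminating `v` leaves 8 b₃. Once this
    -- vanishes, the residue has the same coefficient as the large terms.
    ε = + 8 ℤ.* (b 3F ℤ.- b 0F)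
    ∣-sign∣≤2 : ∀ i → ∣ ℤ.- b i ∣ ≤ 2
    ∣-sign∣≤2 i = subst (_≤ 2) (sym (ℤₚ.∣-i∣≡∣i∣ (b i))) (∣sign∣≤2 (sign i))
    E₂-bound : ∣ E₂ ∣ ≤ 2 * total c + 2 * v + 16
    E₂-bound = ≤-trans (ℤₚ.∣i+j∣≤∣i∣+∣j∣ (Σbc ℤ.+ ℤ.- b 3F ℤ.* + v) _)
      (+-mono-≤
        (≤-trans (ℤₚ.∣i+j∣≤∣i∣+∣j∣ Σbc _)
          (+-mono-≤ (∣·∣-≤ (λ i → b (4+ i)) c (λ i → ∣sign∣≤2 (sign (4+ i)))) (∣*∣-≤ (ℤ.- b 3F) v (∣-sign∣≤2 3F))))
        (∣*∣-≤ (ℤ.- b 0F) 8 (∣-sign∣≤2 0F)))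
    E₂-small : ∣ E₂ ∣ < γ
    E₂-small = ≤-<-trans E₂-bound γ-large
    E₁-small : ∣ E₁ ∣ < β
    E₁-small = ≤-<-trans (ℤₚ.∣i+j∣≤∣i∣+∣j∣ ((b 0F ℤ.- b 2F) ℤ.* + γ) E₂)
      (≤-<-trans (+-mono-≤ (∣*∣-≤ (b 0F ℤ.- b 2F) γ (sign-difference (sign 0F) (sign 2F))) E₂-bound) β-large)
    ε-small : ∣ ε ∣ ≤ 16
    ε-small = subst (_≤ 16) (sym (ℤₚ.abs-* (+ 8) (b 3F ℤ.- b 0F)))
      (*-monoʳ-≤ 8 (sign-difference (sign 3F) (sign 0F)))
    eliminate : sumℤ (λ i → b i ℤ.* assemble α β γ v c i) ≡ (b 0F ℤ.- b 1F) ℤ.* + β ℤ.+ E₁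
    eliminate = trans
      (cong (λ a → b 0F ℤ.* a ℤ.+ (b 1F ℤ.* (ℤ.- + β) ℤ.+ (b 2F ℤ.* (ℤ.- + γ) ℤ.+ (b 3F ℤ.* (ℤ.- + v) ℤ.+ Σbc)))) +α≡)
      (regroup (b 0F) (b 1F) (b 2F) (b 3F) (+ β) (+ γ) (+ v) Σbc (+ 8))
      where
      regroup : ∀ b₀ b₁ b₂ b₃ β γ v s e →
        b₀ ℤ.* (β ℤ.+ γ ℤ.- e) ℤ.+ (b₁ ℤ.* (ℤ.- β) ℤ.+ (b₂ ℤ.* (ℤ.- γ) ℤ.+ (b₃ ℤ.* (ℤ.- v) ℤ.+ s))) ≡
        (b₀ ℤ.- b₁) ℤ.* β ℤ.+ ((b₀ ℤ.- b₂) ℤ.* γ ℤ.+ ((s ℤ.+ ℤ.- b₃ ℤ.* v) ℤ.+ ℤ.- b₀ ℤ.* e))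
      regroup = ℤSolver.solve-∀
    eliminate-v : (λ i → b (4+ i) ℤ.- b 3F) · c ℤ.+ ε ≡ E₂
    eliminate-v = begin
      (λ i → b (4+ i) ℤ.- b 3F) · c ℤ.+ ε
        ≡⟨ cong (ℤ._+ ε) (·-shift (λ i → b (4+ i)) c (b 3F)) ⟩
      Σbc ℤ.- b 3F ℤ.* + total c ℤ.+ ε
        ≡⟨ regroup Σbc (b 3F) (b 0F) (+ total c) (+ 8) ⟩
      (Σbc ℤ.+ ℤ.- b 3F ℤ.* (+ total c ℤ.- + 8)) ℤ.+ ℤ.- b 0F ℤ.* + 8
        ≡⟨ cong (λ v → (Σbc ℤ.+ ℤ.- b 3F ℤ.* v) ℤ.+ ℤ.- b 0F ℤ.* + 8) +v≡ ⟨
      E₂ ∎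
      where
      open ≡-Reasoning
      regroup : ∀ s b₃ b₀ t e → s ℤ.- b₃ ℤ.* t ℤ.+ e ℤ.* (b₃ ℤ.- b₀) ≡
        (s ℤ.+ ℤ.- b₃ ℤ.* (t ℤ.- e)) ℤ.+ ℤ.- b₀ ℤ.* e
      regroup = ℤSolver.solve-∀

-- Auxiliary facts on powers, products and small divisors.

coprime-^² : ∀ {a b} → Coprime a b → ∀ m n → Coprime (a ^ m) (b ^ n)
coprime-^² ab m n = Coprimality.sym (coprime-^ (Coprimality.sym (coprime-^ ab n)) m)

^-distribʳ-* : ∀ k m n → (m * n) ^ k ≡ m ^ k * n ^ k
^-distribʳ-* zero    m n = refl
^-distribʳ-* (suc k) m n = trans (cong (m * n *_) (^-distribʳ-* k m n))
  ([m*n]*[o*p]≡[m*o]*[n*p] m n (m ^ k) (n ^ k))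

∣-pos : ∀ {m n} → m ∣ n → 0 < n → 0 < m
∣-pos {zero}  0∣n n>0 = subst (0 <_) (0∣⇒≡0 0∣n) n>0
∣-pos {suc m} _   _   = z<s

pairwise-≗ : ∀ {n} {c d : Vector ℕ n} → (∀ i → c i ≡ d i) → PairwiseCoprime c → PairwiseCoprime d
pairwise-≗ c≗d c⊥c i j i≢j = subst₂ Coprime (c≗d i) (c≗d j) (c⊥c i j i≢j)

∣head∣≤maxAbs : ∀ {n} (a : Tuple (suc n)) → ∣ a 0F ∣ ≤ maxAbs a
∣head∣≤maxAbs a = m≤m⊔n ∣ a 0F ∣ (maxAbs (tail a))

∣prodℤ∣ : ∀ {n} (a : Tuple (suc n)) → ∣ prodℤ a ∣ ≡ ∣ a 0F ∣ * ∣ prodℤ (tail a) ∣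
∣prodℤ∣ a = ℤₚ.abs-* (a 0F) (prodℤ (tail a))

prodℤ-pos : ∀ {n} (a : Tuple n) → (∀ i → 0 < ∣ a i ∣) → 0 < ∣ prodℤ a ∣
prodℤ-pos {zero}  a pos = z<s
prodℤ-pos {suc n} a pos = subst (0 <_) (sym (∣prodℤ∣ a))
  (*-pos (pos 0F) (prodℤ-pos (tail a) (pos ∘ suc)))

divisor-of-10 : ∀ {f} → 3 ≤ f → f ∣ 10 → f ≡ 5 ⊎ f ≡ 10
divisor-of-10 {1} (s≤s ()) _
divisor-of-10 {2} (s≤s (s≤s ())) _
divisor-of-10 {3} _ f∣10 = contradiction f∣10 (from-no (3 ∣? 10))
divisor-of-10 {4} _ f∣10 = contradiction f∣10 (from-no (4 ∣? 10))
divisor-of-10 {5} _ _    = inj₁ refl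
divisor-of-10 {6} _ f∣10 = contradiction f∣10 (from-no (6 ∣? 10))
divisor-of-10 {7} _ f∣10 = contradiction f∣10 (from-no (7 ∣? 10))
divisor-of-10 {8} _ f∣10 = contradiction f∣10 (from-no (8 ∣? 10))
divisor-of-10 {9} _ f∣10 = contradiction f∣10 (from-no (9 ∣? 10))
divisor-of-10 {10} _ _   = inj₂ refl
divisor-of-10 {suc (suc (suc (suc (suc (suc (suc (suc (suc (suc (suc f))))))))))} _ f∣10 =
  contradiction f∣10 (>⇒∤ (m≤m+n 11 f))

odd⇒5+2h : ∀ {n} → 5 ≤ n → ¬ (2 ∣ n) → ∃[ h ] n ≡ 5 + h * 2
odd⇒5+2h {n} 5≤n 2∤n with m≤n⇒∃[o]m+o≡n 5≤n
... | m , refl with 2 ∣? m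
...   | yes (divides h m≡) = h , cong (λ m → 5 + m) m≡
...   | no 2∤m = contradiction (odd+5 m 2∤m) 2∤n
  where
  odd+5 : ∀ m → ¬ (2 ∣ m) → 2 ∣ 5 + m
  odd+5 zero          odd = contradiction (2 ∣0) odd
  odd+5 (suc zero)    odd = divides 3 refl
  odd+5 (suc (suc m)) odd =
    ∣m∣n⇒∣m+n {2} {2} ∣-refl (odd+5 m (odd ∘ ∣m∣n⇒∣m+n {2} {2} ∣-refl))

-- The quintic identity and its size estimates.

-- Only even powers of x survive in (x+1)⁵ - (x-1)⁵ = 10x⁴ + 20x² + 2. Using z = x - 1 as the
-- variable avoids subtraction.
quintic-identity : ∀ z → let x = suc z ; s = suc (x * x) in
  suc x ^ 5 + 8 ≡ z ^ 5 + 10 * (s * s)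
quintic-identity = solve 1 (λ z → let x = con 1 :+ z ; s = con 1 :+ x :* x in
  (con 1 :+ x) :^ 5 :+ con 8 := z :^ 5 :+ con 10 :* (s :* s)) refl
  where open +-*-Solver

-- Degree 4 against degree 5: s ≤ 2z² bounds the left side by 81z⁴, so z ≥ 82 would do and 200 is a
-- generous choice.
quintic-dominates : ∀ {H z} → H + 200 ≤ z → let x = suc z ; s = suc (x * x) in
  2 * (10 * (s * s)) + H < z ^ 5
quintic-dominates {H} {z} H+200≤z = begin-strict
  2 * (10 * (s * s)) + H                  ≡⟨ cong (_+ H) (sym (*-assoc 2 10 (s * s))) ⟩
  20 * (s * s) + H                        ≤⟨ +-mono-≤ (*-monoʳ-≤ 20 (*-mono-≤ s≤2z² s≤2z²)) (m+n≤o⇒m≤o H H+200≤z) ⟩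
  20 * (2 * (z * z) * (2 * (z * z))) + z  ≡⟨ cong (_+ z) (regroup z) ⟩
  80 * z ^ 4 + z
    ≤⟨ +-monoʳ-≤ (80 * z ^ 4) (subst (_≤ z ^ 4) (^-identityʳ z) (^-monoʳ-≤ z {1} {4} (s≤s z≤n))) ⟩
  80 * z ^ 4 + z ^ 4                      ≡⟨ +-comm (80 * z ^ 4) (z ^ 4) ⟩
  81 * z ^ 4                              <⟨ *-monoˡ-< (z ^ 4) {{m^n≢0 z 4}} (≤-trans (m≤m+n 82 118) 200≤z) ⟩
  z ^ 5                                   ∎
  where
  open ≤-Reasoning
  200≤z : 200 ≤ z
  200≤z = m+n≤o⇒n≤o H H+200≤z
  instance
    z≢0 : NonZero z
    z≢0 = >-nonZero (≤-trans (s≤s z≤n) 200≤z)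
  x s : ℕ
  x = suc z
  s = suc (x * x)
  regroup : ∀ z → 20 * (2 * (z * z) * (2 * (z * z))) ≡ 80 * z ^ 4
  regroup = solve 1 (λ z →
    con 20 :* (con 2 :* (z :* z) :* (con 2 :* (z :* z))) := con 80 :* z :^ 4) refl
    where open +-*-Solver
  expand : ∀ z → suc (suc z * suc z) ≡ z * z + (2 * z + 2)
  expand = solve-∀
  s≤2z² : s ≤ 2 * (z * z)
  s≤2z² = begin
    s                      ≡⟨ expand z ⟩
    z * z + (2 * z + 2)    ≤⟨ +-monoʳ-≤ (z * z) (+-monoʳ-≤ (2 * z) (≤-trans (m≤m+n 2 198) 200≤z)) ⟩
    z * z + (2 * z + z)    ≡⟨ cong (λ u → z * z + u) (+-comm (2 * z) z) ⟩
    z * z + 3 * z          ≤⟨ +-monoʳ-≤ (z * z) (*-monoˡ-≤ z (≤-trans (m≤m+n 3 197) 200≤z)) ⟩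
    z * z + z * z          ≡⟨ cong (λ u → z * z + u) (sym (+-identityʳ (z * z))) ⟩
    2 * (z * z)            ∎

y≤x : ∀ {D x y} → 0 < D → x * x ≡ suc (D * (y * y)) → y ≤ x
y≤x {D} {x} {y} D>0 x²≡ = ≮⇒≥ λ x<y → <⇒≱ (*-mono-< x<y x<y) (begin
  y * y              ≤⟨ m≤n*m (y * y) D {{>-nonZero D>0}} ⟩
  D * (y * y)        ≤⟨ n≤1+n _ ⟩
  suc (D * (y * y))  ≡⟨ x²≡ ⟨
  x * x              ∎)
  where open ≤-Reasoning

-- Membership and quality of the tuple of a Pell solution.

module _ {G k : ℕ} (σ : Splitting G k) where
  open Splitting σ

  private
    v = 2 + w
    -- Both `q` and `H` depend on the splitting alone and stay fixed while `z` grows.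
    q = ∣ prodℤ {suc k} (ℤ.- + v ∷ (+_ ∘ c)) ∣
    H = 2 * total c + 2 * v + 16

  tuple : ℕ → Tuple (4 + k)
  tuple z = assemble (suc x ^ 5) (z ^ 5) (10 * (s * s)) v c
    where
    x s : ℕ
    x = suc z
    s = suc (x * x)

  module _ (10∣G : 10 ∣ G) {z : ℕ} (N∣x : modulus * v ∣ suc z) where

    private
      x s : ℕ
      x = suc z
      s = suc (x * x)
      a = tuple z

      absolute : Vector ℕ (4 + k)
      absolute = suc x ^ 5 ∷ z ^ 5 ∷ 10 * (s * s) ∷ v ∷ c

      ∣a∣≡ : ∀ i → ∣ a i ∣ ≡ absolute i
      ∣a∣≡ 0F = refl
      ∣a∣≡ 1F = ℤₚ.∣-i∣≡∣i∣ (+ (z ^ 5))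
      ∣a∣≡ 2F = ℤₚ.∣-i∣≡∣i∣ (+ (10 * (s * s)))
      ∣a∣≡ 3F = refl
      ∣a∣≡ (suc (suc (suc (suc i)))) = refl

      modulus∣x : modulus ∣ x
      modulus∣x = ∣-trans (m∣m*n v) N∣x
      v∣x : v ∣ x
      v∣x = ∣-trans (n∣m*n modulus) N∣x
      c∣x : ∀ i → c i ∣ x
      c∣x i = ∣-trans (c∣modulus i) modulus∣x
      G∣x : G ∣ x
      G∣x = ∣-trans G∣modulus modulus∣x
      10∣x : 10 ∣ x
      10∣x = ∣-trans 10∣G G∣x
      2∣x : 2 ∣ x
      2∣x = ∣-trans (divides 5 refl) 10∣x

      s⊥ : ∀ {m} → m ∣ x → Coprime s m
      s⊥ m∣x = suc-coprime (∣m⇒∣m*n x m∣x)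
      α⊥ : ∀ {m} → m ∣ x → Coprime (suc x ^ 5) m
      α⊥ m∣x = Coprimality.sym (coprime-^ (Coprimality.sym (suc-coprime m∣x)) 5)
      β⊥ : ∀ {m} → m ∣ x → Coprime (z ^ 5) m
      β⊥ m∣x = Coprimality.sym (coprime-^ (Coprimality.sym (pred-coprime m∣x)) 5)
      -- The factor 10 divides `x` itself, so it needs a hypothesis of its own.
      γ⊥ : ∀ {m} → m ∣ x → Coprime m 10 → Coprime (10 * (s * s)) m
      γ⊥ m∣x m⊥10 = Coprimality.sym (coprime-* m⊥10 (coprime-* m⊥s m⊥s))
        where
        m⊥s = Coprimality.sym (s⊥ m∣x)

      -- Since s = (x-1)(x+1) + 2, a common divisor of `s` and x ± 1 divides 2, while x ± 1 is odd.
      s≡ : s ≡ z * suc x + 2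
      s≡ = expand z
        where
        expand : ∀ z → suc (suc z * suc z) ≡ z * suc (suc z) + 2
        expand = solve-∀

      x+1⊥x-1 : Coprime (suc x) z
      x+1⊥x-1 {d} (d∣x+1 , d∣z) = suc-coprime 2∣x
        (d∣x+1 , ∣m+n∣m⇒∣n (subst (d ∣_) (+-comm 2 z) d∣x+1) d∣z)
      x+1⊥s : Coprime (suc x) s
      x+1⊥s {d} (d∣x+1 , d∣s) = suc-coprime 2∣x
        (d∣x+1 , ∣m+n∣m⇒∣n (subst (d ∣_) s≡ d∣s) (∣n⇒∣m*n z d∣x+1))
      x-1⊥s : Coprime z s
      x-1⊥s {d} (d∣z , d∣s) = pred-coprime 2∣x
        (d∣z , ∣m+n∣m⇒∣n (subst (d ∣_) s≡ d∣s) (∣m⇒∣m*n (suc x) d∣z))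

      ^⊥γ : ∀ {m} → Coprime m s → Coprime (m ^ 5) 10 → Coprime (m ^ 5) (10 * (s * s))
      ^⊥γ m⊥s m⊥10 = coprime-* m⊥10 (coprime-* m⁵⊥s m⁵⊥s)
        where
        m⁵⊥s = Coprimality.sym (coprime-^ (Coprimality.sym m⊥s) 5)

      v⊥c : ∀ i → Coprime v (c i)
      v⊥c i = coprime-∣ residue⊥modulus (c∣modulus i)
      v⊥10 : Coprime v 10
      v⊥10 = coprime-∣ residue⊥modulus (∣-trans 10∣G G∣modulus)

      absolute-coprime : PairwiseCoprime absolute
      absolute-coprime =
        pairwise-∷ (λ { 0F → coprime-^² x+1⊥x-1 5 5 ; 1F → ^⊥γ x+1⊥s (α⊥ 10∣x)
                      ; 2F → α⊥ v∣x ; (suc (suc (suc i))) → α⊥ (c∣x i) })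
        (pairwise-∷ (λ { 0F → ^⊥γ x-1⊥s (β⊥ 10∣x) ; 1F → β⊥ v∣x ; (suc (suc i)) → β⊥ (c∣x i) })
        (pairwise-∷ (λ { 0F → γ⊥ v∣x v⊥10 ; (suc i) → γ⊥ (c∣x i) (coprime-∣ (c⊥G i) 10∣G) })
        (pairwise-∷ v⊥c c⊥c)))

    tuple-pairwise : ∀ i j → i ≢ j → Coprime ∣ a i ∣ ∣ a j ∣
    tuple-pairwise = pairwise-≗ {c = absolute} {λ i → ∣ a i ∣} (sym ∘ ∣a∣≡) absolute-coprime

    -- Every entry but the third is coprime to `f`. In the third, `f` is coprime to `s`, so it would
    -- have to divide 10.
    tuple-avoids : ∀ {f} → f ∣ G → 3 ≤ f → f ≢ 5 → f ≢ 10 → ∀ i → ¬ (f ∣ ∣ a i ∣)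
    tuple-avoids {f} f∣G 3≤f f≢5 f≢10 i f∣aᵢ = avoid i (subst (f ∣_) (∣a∣≡ i) f∣aᵢ)
      where
      f∣x = ∣-trans f∣G G∣x
      coprime⇒∤ : ∀ {m} → Coprime m f → ¬ (f ∣ m)
      coprime⇒∤ m⊥f f∣m = contradiction (subst (3 ≤_) (m⊥f (f∣m , ∣-refl)) 3≤f) λ { (s≤s ()) }
      f⊥s : Coprime f s
      f⊥s = Coprimality.sym (s⊥ f∣x)
      avoid : ∀ i → ¬ (f ∣ absolute i)
      avoid 0F = coprime⇒∤ (α⊥ f∣x)
      avoid 1F = coprime⇒∤ (β⊥ f∣x)
      avoid 2F f∣γ = [ f≢5 , f≢10 ]′ (divisor-of-10 3≤f
        (coprime-divisor {f} {s * s} {10} (coprime-* f⊥s f⊥s) (subst (f ∣_) (*-comm 10 (s * s)) f∣γ)))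
      avoid 3F = coprime⇒∤ (coprime-∣ residue⊥modulus (∣-trans f∣G G∣modulus))
      avoid (suc (suc (suc (suc i)))) = coprime⇒∤ (coprime-∣ (c⊥G i) f∣G)

    tuple-sum : sumℤ a ≡ + 0
    tuple-sum = assemble-sum {α = suc x ^ 5} {β = z ^ 5} {γ = 10 * (s * s)} {c = c} (quintic-identity z) balance

    tuple-no-subsum : H + 200 ≤ z →
      ¬ (Σ (Tuple (4 + k)) λ b → (∀ i → IsSign (b i)) ×
          (∃[ i ] b i ≡ + 0) × (∃[ j ] b j ≡ + 1) × sumℤ (λ i → b i ℤ.* a i) ≡ + 0)
    tuple-no-subsum H+200≤z (b , sign , (i , bᵢ≡0) , (j , bⱼ≡1) , eq) =
      contradiction (trans (sym bᵢ≡0) (trans (rigid i) (trans (sym (rigid j)) bⱼ≡1))) λ ()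
      where
      γ-large : H < 10 * (s * s)
      γ-large = begin-strict
        H             ≤⟨ m+n≤o⇒m≤o H H+200≤z ⟩
        z             <⟨ n<1+n z ⟩
        x             ≤⟨ m≤m*n x x ⟩
        x * x         ≤⟨ n≤1+n _ ⟩
        s             ≤⟨ m≤m*n s s ⟩
        s * s         ≤⟨ m≤n*m (s * s) 10 ⟩
        10 * (s * s)  ∎
        where open ≤-Reasoning
      rigid : ∀ i → b i ≡ b 0F
      rigid = assemble-rigid {α = suc x ^ 5} {β = z ^ 5} {γ = 10 * (s * s)} {c = c}
        (quintic-identity z) balance decreasing γ-large (quintic-dominates H+200≤z) b sign eq

    -- The Pell equation gives (x+1)(x-1) = Dy², so the two fifth powers contribute at most Dy to
    -- the radical. As y ≤ x and s ≤ 2x², the radical is at most Kx³.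
    tuple-quality : ∀ {D y} → 0 < z → 0 < D → x * x ≡ suc (D * (y * y)) →
      ∀ p r → 3 * p < 5 * r → (20 * D * q) ^ p < x → QualityAbove a p r
    tuple-quality {D} {y} z>0 D>0 x²≡ p r 3p<5r K^p<x =
      R , isRad , (begin-strict
        R ^ p                  ≤⟨ ^-monoˡ-≤ p R≤ ⟩
        (K * x ^ 3) ^ p        ≡⟨ ^-distribʳ-* p K (x ^ 3) ⟩
        K ^ p * (x ^ 3) ^ p    ≡⟨ cong (K ^ p *_) (^-*-assoc x 3 p) ⟩
        -- The gap `3 * p < 5 * r` leaves one spare power of `x`, which absorbs `K ^ p`.
        K ^ p * x ^ (3 * p)    <⟨ *-monoˡ-< (x ^ (3 * p)) {{m^n≢0 x (3 * p)}} K^p<x ⟩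
        x ^ suc (3 * p)        ≤⟨ ^-monoʳ-≤ x 3p<5r ⟩
        x ^ (5 * r)            ≡⟨ ^-*-assoc x 5 r ⟨
        (x ^ 5) ^ r            ≤⟨ ^-monoˡ-≤ r (^-monoˡ-≤ 5 (n≤1+n x)) ⟩
        (suc x ^ 5) ^ r        ≤⟨ ^-monoˡ-≤ r (∣head∣≤maxAbs a) ⟩
        maxAbs a ^ r           ∎)
      where
      open ≤-Reasoning
      K = 20 * D * q
      Z = ∣ prodℤ a ∣
      m = D * y * 10 * s * q

      absolute-pos : ∀ i → 0 < absolute i
      absolute-pos 0F = m^n>0 (suc x) 5
      absolute-pos 1F = m^n>0 z {{>-nonZero z>0}} 5
      absolute-pos 2F = z<s
      absolute-pos 3F = z<s
      absolute-pos (suc (suc (suc (suc i)))) = ∣-pos (c∣modulus i) modulus>0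

      Z>0 : 0 < Z
      Z>0 = prodℤ-pos a (λ i → subst (0 <_) (sym (∣a∣≡ i)) (absolute-pos i))

      Z≡ : Z ≡ (D * (y * y)) ^ 5 * (10 * (s * s) * q)
      Z≡ = begin-equality
        Z ≡⟨ ∣prodℤ∣ a ⟩
        suc x ^ 5 * ∣ prodℤ (tail a) ∣ ≡⟨ cong (suc x ^ 5 *_) (∣prodℤ∣ (tail a)) ⟩
        suc x ^ 5 * (∣ a 1F ∣ * ∣ prodℤ (tail (tail a)) ∣)
          ≡⟨ cong₂ (λ β t → suc x ^ 5 * (β * t)) (∣a∣≡ 1F) (∣prodℤ∣ (tail (tail a))) ⟩
        suc x ^ 5 * (z ^ 5 * (∣ a 2F ∣ * q))
          ≡⟨ cong (λ γ → suc x ^ 5 * (z ^ 5 * (γ * q))) (∣a∣≡ 2F) ⟩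
        suc x ^ 5 * (z ^ 5 * (10 * (s * s) * q)) ≡⟨ *-assoc (suc x ^ 5) (z ^ 5) _ ⟨
        suc x ^ 5 * z ^ 5 * (10 * (s * s) * q) ≡⟨ cong (_* (10 * (s * s) * q)) (^-distribʳ-* 5 (suc x) z) ⟨
        (suc x * z) ^ 5 * (10 * (s * s) * q) ≡⟨ cong (λ u → u ^ 5 * (10 * (s * s) * q)) x²-1≡ ⟩
        (D * (y * y)) ^ 5 * (10 * (s * s) * q) ∎
        where
        expand : ∀ z → suc (suc (suc z) * z) ≡ suc z * suc z
        expand = solve-∀
        x²-1≡ : suc x * z ≡ D * (y * y)
        x²-1≡ = suc-injective (trans (expand z) x²≡)

      -- This makes `m` positive, so that a divisor of `m` is bounded by it.
      m∣Z : m ∣ Z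
      m∣Z = divides (D ^ 4 * y ^ 9 * s) (trans Z≡ (regroup D y 10 s q))
        where
        regroup : ∀ D y t s q → (D * (y * y)) ^ 5 * (t * (s * s) * q) ≡
          (D ^ 4 * y ^ 9 * s) * (D * y * t * s * q)
        regroup = solve 5 (λ D y t s q → (D :* (y :* y)) :^ 5 :* (t :* (s :* s) :* q) :=
          (D :^ 4 :* y :^ 9 :* s) :* (D :* y :* t :* s :* q)) refl
          where open +-*-Solver
      -- The exponent 10 is that of `y` in (Dy²)⁵. A squarefree divisor of `Z` therefore divides
      -- `m`, whether or not `m` is squarefree.
      Z∣m^10 : Z ∣ m ^ 10
      Z∣m^10 = divides (D ^ 5 * 10 ^ 9 * s ^ 8 * q ^ 9)
        (trans (regroup D y 10 s q) (cong ((D ^ 5 * 10 ^ 9 * s ^ 8 * q ^ 9) *_) (sym Z≡)))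
        where
        regroup : ∀ D y t s q → (D * y * t * s * q) ^ 10 ≡
          (D ^ 5 * t ^ 9 * s ^ 8 * q ^ 9) * ((D * (y * y)) ^ 5 * (t * (s * s) * q))
        regroup = solve 5 (λ D y t s q → (D :* y :* t :* s :* q) :^ 10 :=
          (D :^ 5 :* t :^ 9 :* s :^ 8 :* q :^ 9) :* ((D :* (y :* y)) :^ 5 :* (t :* (s :* s) :* q))) refl
          where open +-*-Solver

      rad = rad-exists Z Z>0
      R = proj₁ rad
      isRad = proj₂ rad

      R∣m : R ∣ m
      R∣m = let _ , sf , R∣Z , _ = isRad in squareFree-∣^ sf 9 (∣-trans R∣Z Z∣m^10)

      s≤2x² : s ≤ 2 * (x * x)
      s≤2x² = +-mono-≤ {1} {x * x} (s≤s z≤n) (≤-reflexive (sym (+-identityʳ (x * x))))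

      R≤ : R ≤ K * x ^ 3
      R≤ = begin
        R                                 ≤⟨ ∣⇒≤ {{>-nonZero (∣-pos m∣Z Z>0)}} R∣m ⟩
        D * y * 10 * s * q                ≤⟨ *-monoˡ-≤ q (*-mono-≤ (*-monoˡ-≤ 10 (*-monoʳ-≤ D (y≤x D>0 x²≡))) s≤2x²) ⟩
        D * x * 10 * (2 * (x * x)) * q    ≡⟨ regroup D x q ⟩
        K * x ^ 3                         ∎
        where
        regroup : ∀ D x q → D * x * 10 * (2 * (x * x)) * q ≡ 20 * D * q * x ^ 3
        regroup = solve 3 (λ D x q → D :* x :* con 10 :* (con 2 :* (x :* x)) :* q :=
          con 20 :* D :* q :* x :^ 3) refl
          where open +-*-Solver

-- Choice of the parameters and conclusion.

≤-sum-map : ∀ {A : Set} (g : A → ℕ) (xs : List A) → All (λ y → g y ≤ sum (map g xs)) xs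
≤-sum-map g List.[]       = All.[]
≤-sum-map g (y List.∷ ys) = m≤m+n (g y) _ All.∷ All.map (λ le → ≤-trans le (m≤n+m _ (g y))) (≤-sum-map g ys)

-- The factor 64 ≡ 1 modulo 7 makes t large and divisible by 8, as base requires.
splitting-coprime-to : ∀ P → 0 < P → ∀ h → ∃[ G ] P ∣ G × Splitting G (suc (h * 2))
splitting-coprime-to P P>0 h with multiple-≡1-mod-7 P P>0
... | e , t , k , P∣ , refl = 7 ^ e * (64 * t) ,
  ∣-trans P∣ (*-monoʳ-∣ (7 ^ e) (n∣m*n 64)) ,
  splitting e {64 * t} {9 + 64 * k} (m≤m*n 64 t) (∣m⇒∣m*n {8} {64} t (divides 8 refl)) (expand k) h
  where
  expand : ∀ k → 64 * suc (7 * k) ≡ suc (7 * (9 + 64 * k))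
  expand = solve-∀

-- `D` is chosen before the bound `B`, so the constant in the radical estimate does not grow with
-- the solution. The residue is at least 2, which makes N² - 1 positive.
pell-for-splitting : ∀ {G k} (σ : Splitting G k) → let open Splitting σ in
  ∃[ D ] 0 < D × (∀ B → ∃[ z ] ∃[ y ]
    suc z * suc z ≡ suc (D * (y * y)) × modulus * (2 + w) ∣ suc z × B ≤ z)
pell-for-splitting σ = D , D>0 , solution
  where
  open Splitting σ
  N = modulus * (2 + w)
  D = pred (N * N)
  N≥2 : 2 ≤ N
  N≥2 = ≤-trans (m≤m+n 2 w) (m≤n*m (2 + w) modulus {{>-nonZero modulus>0}})
  N²≥4 : 4 ≤ N * N
  N²≥4 = *-mono-≤ N≥2 N≥2
  N²≡ : N * N ≡ suc D
  N²≡ = sym (suc-pred (N * N) {{>-nonZero (≤-trans (s≤s z≤n) N²≥4)}})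
  D>0 : 0 < D
  D>0 = s≤s⁻¹ (subst (2 ≤_) N²≡ (≤-trans (m≤m+n 2 2) N²≥4))
  solution : ∀ B → _
  solution B with pell (≤-trans (s≤s z≤n) N≥2) D>0 N²≡ B
  ... | suc z , y , x²≡ , N∣x , s≤s B≤z = z , y , x²≡ , N∣x , B≤z

-- The limit superior is at least 5/3 exactly when no finite list `S` exhausts the tuples of quality
-- above p/r, for any p/r < 5/3.
theorem1p12 : (F : List ℕ) → (∀ f → f ∈ F → 3 ≤ f) →
    2 ∉ F → 5 ∉ F → 10 ∉ F →
    (n : ℕ) → 5 ≤ n → ¬ (2 ∣ n) →
    (p r : ℕ) → .{{_ : NonZero r}} → 3 * p < 5 * r →
    (S : List (Tuple n)) →
    Σ (Tuple n) λ a → InU F n a × All (Differs a) S × QualityAbove a p r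
theorem1p12 F 3≤F _ 5∉F 10∉F n 5≤n 2∤n p r 3p<5r S with odd⇒5+2h 5≤n 2∤n
... | h , refl = a ,
  ( tuple-pairwise σ 10∣G N∣x
  , tuple-sum σ 10∣G N∣x
  , tuple-no-subsum σ 10∣G N∣x H+200≤z
  , λ f f∈F → tuple-avoids σ 10∣G N∣x (F∣G f∈F) (3≤F f f∈F)
      (λ f≡5 → 5∉F (subst (_∈ F) f≡5 f∈F)) (λ f≡10 → 10∉F (subst (_∈ F) f≡10 f∈F)) ) ,
  All.map differs (≤-sum-map (λ s → ∣ s 0F ∣) S) ,
  tuple-quality σ 10∣G N∣x {y = y} z>0 D>0 x²≡ p r 3p<5r K^p<x
  where
  -- The factor 10 makes the splitting coprime to the coefficient of (x²+1)²; the product does the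
  -- same for the elements of `F`.
  P = 10 * product F
  P>0 : 0 < P
  P>0 = *-pos {10} z<s (>-nonZero⁻¹ (product F)
    {{product≢0 (All.tabulate λ f∈F → >-nonZero (≤-trans (s≤s z≤n) (3≤F _ f∈F)))}})

  split = splitting-coprime-to P P>0 h
  G = proj₁ split
  P∣G = proj₁ (proj₂ split)
  σ : Splitting G (suc (h * 2))
  σ = proj₂ (proj₂ split)
  open Splitting σ

  10∣G : 10 ∣ G
  10∣G = ∣-trans (m∣m*n (product F)) P∣G
  F∣G : ∀ {f} → f ∈ F → f ∣ G
  F∣G f∈F = ∣-trans (∣n⇒∣m*n 10 (∈⇒∣product f∈F)) P∣G

  eq = pell-for-splitting σ
  D = proj₁ eq
  D>0 = proj₁ (proj₂ eq)
  K = 20 * D * ∣ prodℤ {suc (suc (h * 2))} (ℤ.- + (2 + w) ∷ (+_ ∘ c)) ∣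
  H = 2 * total c + 2 * (2 + w) + 16
  M = sum (map (λ s → ∣ s 0F ∣) S)
  -- One solution beyond three bounds: `K ^ p` for the quality, `M` to leave the list `S`, and
  -- `H + 200` to exclude subsums.
  point = proj₂ (proj₂ eq) (K ^ p + (M + (H + 200)))
  z = proj₁ point
  y = proj₁ (proj₂ point)
  x²≡ = proj₁ (proj₂ (proj₂ point))
  N∣x = proj₁ (proj₂ (proj₂ (proj₂ point)))
  large : K ^ p + (M + (H + 200)) ≤ z
  large = proj₂ (proj₂ (proj₂ (proj₂ point)))

  K^p<x : K ^ p < suc z
  K^p<x = s≤s (m+n≤o⇒m≤o (K ^ p) large)
  M≤z : M ≤ z
  M≤z = m+n≤o⇒m≤o M (m+n≤o⇒n≤o (K ^ p) large)
  H+200≤z : H + 200 ≤ z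
  H+200≤z = m+n≤o⇒n≤o M (m+n≤o⇒n≤o (K ^ p) large)
  z>0 : 0 < z
  z>0 = ≤-trans (s≤s z≤n) (m+n≤o⇒n≤o H H+200≤z)

  a : Tuple (5 + h * 2)
  a = tuple σ z

  differs : ∀ {s} → ∣ s 0F ∣ ≤ M → Differs a s
  differs {s} s₀≤M = 0F , λ a₀≡s₀ → <⇒≢ s₀<a₀ (sym (cong ∣_∣ a₀≡s₀))
    where
    open ≤-Reasoning
    s₀<a₀ : ∣ s 0F ∣ < suc (suc z) ^ 5
    s₀<a₀ = begin-strict
      ∣ s 0F ∣              ≤⟨ ≤-trans s₀≤M M≤z ⟩
      z                     <⟨ m≤n⇒m≤1+n ≤-refl ⟩
      suc (suc z)           ≡⟨ ^-identityʳ (suc (suc z)) ⟨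
      suc (suc z) ^ 1       ≤⟨ ^-monoʳ-≤ (suc (suc z)) {1} {5} (s≤s z≤n) ⟩
      suc (suc z) ^ 5       ∎
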